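{- Let $\mathcal{N}$ be a deterministic non-erasing Turing machine with a single binary tape that runs in time $t$. Then there is a Wang B machine $\mathcal{W}_{\mathcal{N}}$ that simulates the computation of $\mathcal{N}$ in time $O(t)$.
   Context: **Binary Turing machine.** A (deterministic, single-tape) binary Turing machine is a tuple $M=(Q,\{0,1\},f,q_0,q_{|Q|-1})$, where $Q$ is a finite set of states, $\{0,1\}$ is the tape alphabet, $0$ is the blank symbol, $q_0\in Q$ is the start state and $q_{|Q|-1}\in Q$ is the halt state. The transition function $f: Q\times\{0,1\}\to\{0,1\}\times\{L,R\}\times Q$ is undefined exactly on $\{q_{|Q|-1}\}\times\{0,1\}$. A rule $(q_i,x_1,x_2,D,q_j)$ means: in state $q_i$ reading $x_1$, write $x_2$, move the head one cell in direction $D$, and enter state $q_j$. The tape is bi-infinite and all but finitely many cells contain $0$. **Non-erasing Turing machine.** A binary Turing machine with no transition rule that overwrites $1$ with $0$, i.e. no rule of the form $(q_j,1,0,D,q_k)$ with $q_j,q_k\in Q$, $D\in\{L,R\}$. **Wang B machine.** A Wang B machine has a single bi-infinite tape over $\{0,1\}$ (blank symbol $0$, finitely many $1$s), one head, and a finite list of instructions $\mathcal{W}=I_0,I_1,\ldots,I_{n-1}$, each of one of the forms: $L$ (move the head one cell left); $R$ (move the head one cell right); $M$ (mark: write $1$ in the current cell); $J(x)$ with $0\le x\le n-1$ (if the current cell contains $1$ then jump to instruction $I_x$, otherwise go on to the next instruction). Execution starts at $I_0$ and one instruction is executed per time step. After executing an $L$, $R$ or $M$ instruction $I_k$, or a jump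 $I_k=J(x)$ while reading $0$, the machine goes to $I_{k+1}$ if $k<n-1$ and halts if $k=n-1$. **Configuration.** A configuration consists of the control state (or current instruction index), the tape contents and the head position. **Simulation.** $B$ simulates the computation of $A$ in time $O(g(t))$ if there are an encoding $\varepsilon$ of initial configurations of $A$ as initial configurations of $B$ and a partial decoding $\delta$ from configurations of $B$ to configurations of $A$, both computable by finite-state transducers acting on the tape contents with the head position marked, such that for every initial configuration $c_0$ of $A$ with successive configurations $c_0,c_1,c_2,\ldots$, the run of $B$ started on $\varepsilon(c_0)$ passes, at times $s_0<s_1<s_2<\cdots$, through configurations decoding under $\delta$ to $c_0,c_1,c_2,\ldots$ respectively; $B$ halts if and only if $A$ halts; and if $A$ runs in time $t$ (halts within $t$ steps) then $B$ runs in time $O(g(t))$, with constant depending only on $A$. -}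

module Defs where

open import Data.Bool.Base using (Bool; true; false; if_then_else_)
open import Data.Fin.Base using (Fin; zero; suc; fromℕ; inject₁)
open import Data.Fin.Relation.Unary.Top using (view; ‵fromℕ; ‵inject₁)
open import Data.Integer.Base using (ℤ; +_; -[1+_])
open import Data.List.Base using (List; []; _∷_; _++_; _ʳ++_; map)
open import Data.Maybe.Base as Maybe using (Maybe; just; nothing; _>>=_)
open import Data.Nat.Base using (ℕ; zero; suc; _*_; _≤_; _<_; _≥_)
open import Data.Product.Base using (Σ-syntax; ∃; ∃-syntax; ∃₂; _×_; _,_)
open import Data.Vec.Base using (Vec; lookup)
open import Function.Bundles using (_⇔_)
open import Relation.Binary.PropositionalEquality using (_≡_; _≢_; _≗_)

------------------------------------------------------------------------
-- Tapes and configurations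

-- The tape symbols 0 and 1 are  false  and  true.

-- A bi-infinite tape with finitely many 1s, seen from the head.  Both
-- lists start with the cell next to the head; all cells beyond the ends of
-- the lists are blank.
record Tape : Set where
  constructor tape
  field
    left  : List Bool
    head  : Bool
    right : List Bool

cellAt : List Bool → ℕ → Bool
cellAt []       _       = false
cellAt (x ∷ xs) zero    = x
cellAt (x ∷ xs) (suc n) = cellAt xs n

-- The content of the cell at a given offset from the head.
read : Tape → ℤ → Bool
read (tape ls h rs) (+ zero)  = h
read (tape ls h rs) (+ suc n) = cellAt rs n
read (tape ls h rs) -[1+ n ]  = cellAt ls n

moveLeft : Tape → Tape
moveLeft (tape []       h rs) = tape [] false (h ∷ rs)
moveLeft (tape (l ∷ ls) h rs) = tape ls l (h ∷ rs)

moveRight : Tape → Tape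
moveRight (tape ls h [])       = tape (h ∷ ls) false []
moveRight (tape ls h (r ∷ rs)) = tape (h ∷ ls) r rs

write : Bool → Tape → Tape
write x (tape ls _ rs) = tape ls x rs

record Config (k : ℕ) : Set where
  constructor config
  field
    control : Fin k
    content : Tape

open Config public

-- Equality of configurations: representations that differ only in the
-- number of blanks listed explicitly denote the same configuration.
infix 4 _≈_
_≈_ : ∀ {k} → Config k → Config k → Set
config q s ≈ config q′ s′ = q ≡ q′ × read s ≗ read s′

------------------------------------------------------------------------
-- Machines and their runs

record Machine : Set where
  field
    controls : ℕ
    start    : Fin controls
    step     : Config controls → Maybe (Config controls)  -- nothing: halted

open Machine public

Conf : Machine → Set
Conf M = Config (controls M)

Initial : (M : Machine) → Conf M → Set
Initial M c = control c ≡ start M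

run : (M : Machine) → ℕ → Conf M → Maybe (Conf M)
run M zero    c = just c
run M (suc n) c = step M c >>= run M n

HaltsAt : (M : Machine) → Conf M → ℕ → Set
HaltsAt M c n = ∃[ c′ ] run M n c ≡ just c′ × step M c′ ≡ nothing

Halts : (M : Machine) → Conf M → Set
Halts M c = ∃[ n ] HaltsAt M c n

HaltsWithin : (M : Machine) → Conf M → ℕ → Set
HaltsWithin M c t = ∃[ n ] n ≤ t × HaltsAt M c n

------------------------------------------------------------------------
-- Binary Turing machines

data Direction : Set where
  L R : Direction

move : Direction → Tape → Tape
move L = moveLeft
move R = moveRight

record BinaryTM : Set where
  field
    lastState : ℕ

  State : Set
  State = Fin (suc lastState)

  haltState : State
  haltState = fromℕ lastState

  field
    rule           : State → Bool → Maybe (Bool × Direction × State)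
    rule-undefined : ∀ q x → rule q x ≡ nothing ⇔ q ≡ haltState

NonErasing : BinaryTM → Set
NonErasing N = ∀ q D q′ → rule q true ≢ just (false , D , q′)
  where open BinaryTM N

turing : BinaryTM → Machine
turing N = record { controls = suc lastState ; start = zero ; step = stepTM }
  where
  open BinaryTM N

  stepTM : Config (suc lastState) → Maybe (Config (suc lastState))
  stepTM (config q s) =
    Maybe.map (λ (x , D , q′) → config q′ (move D (write x s)))
              (rule q (Tape.head s))

------------------------------------------------------------------------
-- Wang B machines

data Instruction (n : ℕ) : Set where
  L R M : Instruction n
  J     : Fin n → Instruction n

record WangB : Set where
  field
    lastIndex : ℕ
    program   : Vec (Instruction (suc lastIndex)) (suc lastIndex)

-- With n instructions the control ranges over Fin (suc n): the values
-- inject₁ k are the instruction indices, and the top value means that the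
-- machine has halted.
instructionIndex : ∀ {n} → Fin (suc n) → Maybe (Fin n)
instructionIndex i with view i
... | ‵fromℕ     = nothing
... | ‵inject₁ k = just k

execute : ∀ {n} → Fin n → Instruction n → Tape → Config (suc n)
execute k L     s = config (suc k) (moveLeft s)
execute k R     s = config (suc k) (moveRight s)
execute k M     s = config (suc k) (write true s)
execute k (J x) s = config (if Tape.head s then inject₁ x else suc k) s

wang : WangB → Machine
wang W = record { controls = suc (suc lastIndex) ; start = zero ; step = stepW }
  where
  open WangB W

  stepW : Config (suc (suc lastIndex)) → Maybe (Config (suc (suc lastIndex)))
  stepW (config i s) =
    Maybe.map (λ k → execute k (lookup program k) s) (instructionIndex i)

------------------------------------------------------------------------
-- Finite-state transducers

-- One-way deterministic transducers, possibly with output at the end of the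
-- input.  The input is rejected when a transition or the final output is
-- undefined.
record Transducer (A B : Set) : Set where
  field
    states     : ℕ
    initial    : Fin states
    transition : Fin states → A → Maybe (Fin states × List B)
    final      : Fin states → Maybe (List B)

  transduceFrom : Fin states → List A → Maybe (List B)
  transduceFrom p []      = final p
  transduceFrom p (a ∷ w) =
    transition p a >>= λ (p′ , u) → Maybe.map (u ++_) (transduceFrom p′ w)

  transduce : List A → Maybe (List B)
  transduce = transduceFrom initial

-- A tape cell; the scanned one is marked with the control state.
Cell : ℕ → Set
Cell k = Bool × Maybe (Fin k)

unmarked : ∀ {k} → Bool → Cell k
unmarked x = x , nothing

word : ∀ {k} → Config k → List (Cell k)
word (config q (tape ls h rs)) =
  map unmarked ls ʳ++ ((h , just q) ∷ map unmarked rs)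

ConfigTransducer : Machine → Machine → Set
ConfigTransducer X Y = Transducer (Cell (controls X)) (Cell (controls Y))

-- T ⊢ c ↦ d :  the partial map on configurations computed by T sends c to d.
infix 4 _⊢_↦_
_⊢_↦_ : ∀ {k l} → Transducer (Cell k) (Cell l) → Config k → Config l → Set
T ⊢ c ↦ d = Transducer.transduce T (word c) ≡ just (word d)

-- The partial map does not depend on the chosen representation of its
-- argument.
Respects≈ : ∀ {k l} → Transducer (Cell k) (Cell l) → Set
Respects≈ T = ∀ {c c′ d} → c ≈ c′ → T ⊢ c ↦ d → ∃[ d′ ] T ⊢ c′ ↦ d′ × d ≈ d′

------------------------------------------------------------------------
-- Simulation

infix 4 _∈O_
_∈O_ : (ℕ → ℕ) → (ℕ → ℕ) → Set
f ∈O g = ∃₂ λ C n₀ → ∀ n → n ≥ n₀ → f n ≤ C * g n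

-- When the run of A is finite, the values of s beyond its end are
-- irrelevant.
PassesThrough : (B A : Machine) → ConfigTransducer B A → Conf B → Conf A → Set
PassesThrough B A δ b₀ c₀ =
  Σ[ s ∈ (ℕ → ℕ) ]
    (∀ i → s i < s (suc i)) ×
    (∀ i c → run A i c₀ ≡ just c →
       ∃₂ λ b a → run B (s i) b₀ ≡ just b × δ ⊢ b ↦ a × a ≈ c)

-- The bound f is chosen before the initial configuration, so it depends
-- on the machines only.
record _Simulates_InTimeO_ (B A : Machine) (g : ℕ → ℕ) : Set where
  field
    ε : ConfigTransducer A B
    δ : ConfigTransducer B A

    ε-respects : Respects≈ ε
    δ-respects : Respects≈ δ

    f     : ℕ → ℕ
    f∈O-g : f ∈O g

    simulates : ∀ c₀ → Initial A c₀ →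
      ∃[ b₀ ] ε ⊢ c₀ ↦ b₀
            × Initial B b₀
            × PassesThrough B A δ b₀ c₀
            × (Halts B b₀ ⇔ Halts A c₀)
            × (∀ t → HaltsWithin A c₀ t → HaltsWithin B b₀ (f t))

{-# OPTIONS --safe #-}

-- A cell x of N becomes a pair of cells of W, a helper followed by x.  The
-- helper is marked whenever the head visits it, so  M  followed by  J y  on a
-- helper is an unconditional jump, the one thing that B machines lack.  As N
-- never erases, the symbol that N writes can be produced by  M  or by doing
-- nothing.  Every helper to the left of the head whose symbol is 1 is itself
-- marked; hence the leftmost 1 is a helper, which tells a one-way transducer
-- where the pairs begin.
module Submission where

open import Defs
open import Data.Bool.Base using (Bool; true; false; if_then_else_)
open import Data.Empty using (⊥-elim)
open import Data.Fin.Base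
  using (Fin; zero; suc; toℕ; fromℕ; inject₁; combine; quotient; remQuot; _↑ˡ_; _↑ʳ_)
open import Data.Fin.Patterns
open import Data.Fin.Properties
  using (toℕ-injective; toℕ-combine; toℕ-inject₁; toℕ-fromℕ; toℕ-↑ˡ; toℕ-↑ʳ; remQuot-combine)
open import Data.Fin.Relation.Unary.Top using (view-fromℕ; view-inject₁)
open import Data.Integer.Base using (+_; -[1+_])
open import Data.List.Base using (List; []; _∷_; _++_; _ʳ++_; map; drop; concatMap)
open import Data.List.Properties using (++-identityʳ; map-∘; map-id)
open import Data.Maybe.Base as Maybe using (Maybe; just; nothing; _>>=_)
import Data.Maybe.Properties as Maybe
open import Data.Nat.Base using (ℕ; zero; suc; _+_; _*_; _≤_; _<_; s≤s)
open import Data.Nat.Properties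
  using (+-suc; +-comm; *-comm; *-distribˡ-+; +-monoʳ-≤; +-mono-≤; *-monoˡ-≤; m≤m*n; m≤n*m;
         m≤n+m; ≤-refl; module ≤-Reasoning)
open import Data.Product.Base using (∃-syntax; ∃₂; _×_; _,_; proj₁; proj₂)
open import Data.Sum.Base using (_⊎_; inj₁; inj₂)
open import Data.Vec.Base as Vec using (Vec; []; _∷_; lookup; tabulate; replicate)
open import Data.Vec.Properties using (lookup∘tabulate; lookup-++ˡ; lookup-++ʳ)
open import Function.Base using (_∘_)
open import Function.Bundles using (_⇔_; mk⇔; Equivalence)
open import Relation.Binary.PropositionalEquality hiding (J)

private
  variable
    k : ℕ

-- Cell lists

cellAt-drop : ∀ m xs n → cellAt (drop m xs) n ≡ cellAt xs (m + n)
cellAt-drop zero    xs       n = refl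
cellAt-drop (suc m) []       n = refl
cellAt-drop (suc m) (x ∷ xs) n = cellAt-drop m xs n

double : List Bool → List Bool
double []       = []
double (x ∷ xs) = x ∷ x ∷ double xs

cellAt-double-even : ∀ xs n → cellAt (double xs) (n * 2) ≡ cellAt xs n
cellAt-double-even []       n       = refl
cellAt-double-even (x ∷ xs) zero    = refl
cellAt-double-even (x ∷ xs) (suc n) = cellAt-double-even xs n

cellAt-double-odd : ∀ xs n → cellAt (double xs) (suc (n * 2)) ≡ cellAt xs n
cellAt-double-odd []       n       = refl
cellAt-double-odd (x ∷ xs) zero    = refl
cellAt-double-odd (x ∷ xs) (suc n) = cellAt-double-odd xs n

double-cong : ∀ xs ys → cellAt xs ≗ cellAt ys → cellAt (double xs) ≗ cellAt (double ys)
double-cong []       []       eq n             = refl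
double-cong []       (y ∷ ys) eq zero          = eq 0
double-cong []       (y ∷ ys) eq (suc zero)    = eq 0
double-cong []       (y ∷ ys) eq (suc (suc n)) = double-cong [] ys (eq ∘ suc) n
double-cong (x ∷ xs) []       eq zero          = eq 0
double-cong (x ∷ xs) []       eq (suc zero)    = eq 0
double-cong (x ∷ xs) []       eq (suc (suc n)) = double-cong xs [] (eq ∘ suc) n
double-cong (x ∷ xs) (y ∷ ys) eq zero          = eq 0
double-cong (x ∷ xs) (y ∷ ys) eq (suc zero)    = eq 0
double-cong (x ∷ xs) (y ∷ ys) eq (suc (suc n)) = double-cong xs ys (eq ∘ suc) n

-- Seen from a symbol, either side of a paired tape begins with a helper, so the odd positions are
-- the symbols.
odds : List Bool → List Bool
odds []           = []
odds (_ ∷ [])     = []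
odds (_ ∷ x ∷ xs) = x ∷ odds xs

cellAt-odds : ∀ xs n → cellAt (odds xs) n ≡ cellAt xs (suc (n * 2))
cellAt-odds []           n       = refl
cellAt-odds (_ ∷ [])     n       = refl
cellAt-odds (_ ∷ x ∷ xs) zero    = refl
cellAt-odds (_ ∷ x ∷ xs) (suc n) = cellAt-odds xs n

odds-cong : ∀ {xs ys} → cellAt xs ≗ cellAt ys → cellAt (odds xs) ≗ cellAt (odds ys)
odds-cong {xs} {ys} eq n =
  trans (cellAt-odds xs n) (trans (eq _) (sym (cellAt-odds ys n)))

read-cong : ∀ {ls ls′ h h′ rs rs′} → cellAt ls ≗ cellAt ls′ → h ≡ h′ →
            cellAt rs ≗ cellAt rs′ → read (tape ls h rs) ≗ read (tape ls′ h′ rs′)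
read-cong l h r (+ zero)  = h
read-cong l h r (+ suc n) = r n
read-cong l h r -[1+ n ]  = l n

-- Runs

-- A record rather than the bare equation, so that the machine, the step count and both
-- configurations can be inferred when runs are composed.
record Steps (X : Machine) (n : ℕ) (c c′ : Conf X) : Set where
  constructor steps
  field
    runs : run X n c ≡ just c′

open Steps

run-+ : ∀ {X m c c′} → Steps X m c c′ → ∀ n → run X (m + n) c ≡ run X n c′
run-+ {X} {zero}  (steps refl) n = refl
run-+ {X} {suc m} {c} (steps eq) n with step X c
... | just _ = run-+ {X} {m} (steps eq) n

single : ∀ {X c c′} → step X c ≡ just c′ → Steps X 1 c c′
single eq = steps (cong (_>>= just) eq)

infixr 5 _▷_
_▷_ : ∀ {X m n c c′ c″} → Steps X m c c′ → Steps X n c′ c″ → Steps X (m + n) c c″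
_▷_ {n = n} r r′ = steps (trans (run-+ r n) (runs r′))

run-past-halt : ∀ X {n m c} → HaltsAt X c n → n < m → run X m c ≡ nothing
run-past-halt X {zero}  {suc m} (_ , refl , halted) _ rewrite halted = refl
run-past-halt X {suc n} {suc m} {c} (c′ , eq , halted) (s≤s n<m) with step X c
... | just _ = run-past-halt X (c′ , eq , halted) n<m

run-nothing⇒halts : ∀ X n {c} → run X n c ≡ nothing → Halts X c
run-nothing⇒halts X (suc n) {c} eq with step X c in halted
... | nothing = 0 , c , refl , halted
... | just _  with run-nothing⇒halts X n eq
...   | m , c′ , eq′ , halted′ = suc m , c′ , runs (single {X} halted ▷ steps {n = m} eq′) , halted′

haltsAt-+ : ∀ {X m c c′} → Steps X m c c′ → ∀ n → HaltsAt X c′ n → HaltsAt X c (m + n)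
haltsAt-+ r n (c″ , eq , halted) = c″ , runs (r ▷ steps {n = n} eq) , halted

-- Transducers

private
  parse : List Bool → List (Cell k) → Maybe (Config k)
  parse ls []                  = nothing
  parse ls ((x , nothing) ∷ w) = parse (x ∷ ls) w
  parse ls ((x , just q) ∷ w)  = just (config q (tape ls x (map proj₁ w)))

  parse-left : ∀ ls ls′ (w : List (Cell k)) →
               parse ls′ (map unmarked ls ʳ++ w) ≡ parse (ls ++ ls′) w
  parse-left []       ls′ w = refl
  parse-left (l ∷ ls) ls′ w = parse-left ls ls′ (unmarked l ∷ w)

  parse-word : (c : Config k) → parse [] (word c) ≡ just c
  parse-word (config q (tape ls h rs))
    rewrite parse-left ls [] ((h , just q) ∷ map unmarked rs)
          | ++-identityʳ ls =
    cong (λ rs → just (config q (tape ls h rs))) (trans (sym (map-∘ rs)) (map-id rs))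

-- `parse` is a left inverse of `word`. This is needed because `_⊢_↦_` speaks of words only, whereas
-- `Respects≈` compares configurations.
word-injective : {c d : Config k} → word c ≡ word d → c ≡ d
word-injective {c = c} {d} eq =
  Maybe.just-injective
    (trans (sym (parse-word c)) (trans (cong (parse []) eq) (parse-word d)))

-- The encoding transducer

module Encoder {k l : ℕ} (start : Fin l) where

  -- The scanned helper is marked and carries the head, so that the initial `R` of the program
  -- leaves a marked helper behind. Every other helper copies its symbol.
  encodeCell : Cell k → List (Cell l)
  encodeCell (x , nothing) = unmarked x ∷ unmarked x ∷ []
  encodeCell (x , just _)  = (true , just start) ∷ unmarked x ∷ []

  encoder : Transducer (Cell k) (Cell l)
  encoder = record
    { states     = 1
    ; initial    = zero
    ; transition = λ p a → just (p , encodeCell a)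
    ; final      = λ _ → just []
    }

  open Transducer encoder using (transduce)

  encode : Config k → Config l
  encode (config _ (tape ls x rs)) =
    config start (tape (double ls) true (x ∷ double rs))

  private
    transduce-concatMap : ∀ w → transduce w ≡ just (concatMap encodeCell w)
    transduce-concatMap []      = refl
    transduce-concatMap (a ∷ w) rewrite transduce-concatMap w = refl

    concatMap-left : ∀ ls w → concatMap encodeCell (map unmarked ls ʳ++ w) ≡
                              map unmarked (double ls) ʳ++ concatMap encodeCell w
    concatMap-left []       w = refl
    concatMap-left (l ∷ ls) w = concatMap-left ls (unmarked l ∷ w)

    concatMap-right : ∀ rs → concatMap encodeCell (map unmarked rs) ≡
                             map unmarked (double rs)
    concatMap-right []       = refl
    concatMap-right (r ∷ rs) = cong (λ w → unmarked r ∷ unmarked r ∷ w) (concatMap-right rs)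

  encoder-encode : ∀ c → encoder ⊢ c ↦ encode c
  encoder-encode c@(config q (tape ls x rs)) =
    trans (transduce-concatMap (word c)) (cong just (trans
      (concatMap-left ls ((x , just q) ∷ map unmarked rs))
      (cong (λ w → map unmarked (double ls) ʳ++ ((true , just start) ∷ unmarked x ∷ w))
            (concatMap-right rs))))

  encode-cong : ∀ {c c′} → c ≈ c′ → encode c ≈ encode c′
  encode-cong {config _ (tape ls x rs)} {config _ (tape ls′ x′ rs′)} (_ , eq) =
    refl , read-cong (double-cong ls ls′ (eq ∘ -[1+_])) refl right
    where
    right : cellAt (x ∷ double rs) ≗ cellAt (x′ ∷ double rs′)
    right zero    = eq (+ 0)
    right (suc n) = double-cong rs rs′ (eq ∘ +_ ∘ suc) n

  encoder-respects : Respects≈ encoder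
  encoder-respects {c} {c′} {d} c≈c′ eq =
    encode c′ , encoder-encode c′ , subst (_≈ encode c′) c↦d (encode-cong c≈c′)
    where
    c↦d : encode c ≡ d
    c↦d = word-injective (Maybe.just-injective (trans (sym (encoder-encode c)) eq))

-- The decoding transducer

module Decoder {k l : ℕ} (decodeControl : Fin k → Maybe (Fin l)) where

  pattern leading  = zero
  pattern atSymbol = suc zero
  pattern atHelper = suc (suc zero)

  -- Blanks are skipped up to the leftmost 1, which is taken for a helper; from there on symbols and
  -- helpers alternate, and only symbols are output. The control mark is accepted only on a symbol.
  decoder : Transducer (Cell k) (Cell l)
  decoder = record
    { states     = 3
    ; initial    = leading
    ; transition = transition
    ; final      = λ _ → just []
    }
    where
    transition : Fin 3 → Cell k → Maybe (Fin 3 × List (Cell l))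
    transition leading  (false , nothing) = just (leading , [])
    transition leading  (true  , nothing) = just (atSymbol , [])
    transition atSymbol (x     , nothing) = just (atHelper , unmarked x ∷ [])
    transition atSymbol (x     , just i)  =
      Maybe.map (λ q → atHelper , (x , just q) ∷ []) (decodeControl i)
    transition atHelper (_     , nothing) = just (atSymbol , [])
    transition _        (_     , just _)  = nothing

  open Transducer decoder using (transduceFrom; transduce)

  -- The state reached and the symbols output, latest first, after the cells
  -- of a left list.
  scan : List Bool → Fin 3 × List Bool
  scanCell : Fin 3 × List Bool → Bool → Fin 3 × List Bool

  scan []       = leading , []
  scan (x ∷ xs) = scanCell (scan xs) x

  scanCell (leading  , os) false = leading , os
  scanCell (leading  , os) true  = atSymbol , os
  scanCell (atSymbol , os) x     = atHelper , x ∷ os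
  scanCell (atHelper , os) x     = atSymbol , os

  -- The symbols output before the mark, latest first, already form the left list of the decoded
  -- tape.
  decodeAfter : Fin 3 × List Bool → Fin k → Bool → List Bool → Maybe (Config l)
  decodeAfter (atSymbol , os) i x rs =
    Maybe.map (λ q → config q (tape os x (odds rs))) (decodeControl i)
  decodeAfter _               i x rs = nothing

  decode : Config k → Maybe (Config l)
  decode (config i (tape ls x rs)) = decodeAfter (scan ls) i x rs

  private
    prepend : List Bool → Maybe (List (Cell l)) → Maybe (List (Cell l))
    prepend os = Maybe.map (map unmarked os ʳ++_)

    scanCell-correct : ∀ ((p , os) : Fin 3 × List Bool) x w →
      prepend os (transduceFrom p (unmarked x ∷ w)) ≡
      prepend (proj₂ (scanCell (p , os) x)) (transduceFrom (proj₁ (scanCell (p , os) x)) w)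
    scanCell-correct (leading  , os) false w = sym (Maybe.map-∘ (transduceFrom leading w))
    scanCell-correct (leading  , os) true  w = sym (Maybe.map-∘ (transduceFrom atSymbol w))
    scanCell-correct (atSymbol , os) x     w = sym (Maybe.map-∘ (transduceFrom atHelper w))
    scanCell-correct (atHelper , os) x     w = sym (Maybe.map-∘ (transduceFrom atSymbol w))

    scan-correct : ∀ ls w → transduceFrom leading (map unmarked ls ʳ++ w) ≡
                            prepend (proj₂ (scan ls)) (transduceFrom (proj₁ (scan ls)) w)
    scan-correct []       w = sym (Maybe.map-id _)
    scan-correct (l ∷ ls) w =
      trans (scan-correct ls (unmarked l ∷ w)) (scanCell-correct (scan ls) l w)

    right-correct : ∀ rs → transduceFrom atHelper (map unmarked rs) ≡
                           just (map unmarked (odds rs))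
    right-correct []           = refl
    right-correct (_ ∷ [])     = refl
    right-correct (_ ∷ r ∷ rs) rewrite right-correct rs = refl

    decodeAfter-correct : ∀ ((p , os) : Fin 3 × List Bool) i x rs →
      prepend os (transduceFrom p ((x , just i) ∷ map unmarked rs)) ≡
      Maybe.map word (decodeAfter (p , os) i x rs)
    decodeAfter-correct (leading  , os) i false rs = refl
    decodeAfter-correct (leading  , os) i true  rs = refl
    decodeAfter-correct (atHelper , os) i x     rs = refl
    decodeAfter-correct (atSymbol , os) i x     rs with decodeControl i
    ... | nothing = refl
    ... | just q  rewrite right-correct rs = refl

  decoder-decode : ∀ c → transduce (word c) ≡ Maybe.map word (decode c)
  decoder-decode (config i (tape ls x rs)) =
    trans (scan-correct ls ((x , just i) ∷ map unmarked rs))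
          (decodeAfter-correct (scan ls) i x rs)

  -- Extra blanks at the far end are read first, in state `leading`, and change nothing.
  scan-cong : ∀ xs ys → cellAt xs ≗ cellAt ys → scan xs ≡ scan ys
  scan-cong []       []       eq = refl
  scan-cong []       (y ∷ ys) eq
    rewrite sym (scan-cong [] ys (eq ∘ suc)) | sym (eq 0) = refl
  scan-cong (x ∷ xs) []       eq
    rewrite scan-cong xs [] (eq ∘ suc) | eq 0 = refl
  scan-cong (x ∷ xs) (y ∷ ys) eq = cong₂ scanCell (scan-cong xs ys (eq ∘ suc)) (eq 0)

  private
    decodeAfter-cong : ∀ p i x {rs rs′ d} → cellAt rs ≗ cellAt rs′ →
                       decodeAfter p i x rs ≡ just d →
                       ∃[ d′ ] decodeAfter p i x rs′ ≡ just d′ × d ≈ d′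
    decodeAfter-cong (atSymbol , os) i x {rs} {rs′} eq eq′ with decodeControl i
    decodeAfter-cong (atSymbol , os) i x {rs} {rs′} eq refl | just q =
      _ , refl , refl ,
      read-cong (λ _ → refl) refl (odds-cong {rs} {rs′} eq)

  decode-cong : ∀ {c c′ d} → c ≈ c′ → decode c ≡ just d →
                ∃[ d′ ] decode c′ ≡ just d′ × d ≈ d′
  decode-cong {config i (tape ls x rs)} {config _ (tape ls′ x′ rs′)} (refl , eq) eq′
    rewrite eq (+ 0) | scan-cong ls ls′ (eq ∘ -[1+_]) =
    decodeAfter-cong (scan ls′) i x′ (eq ∘ +_ ∘ suc) eq′

  decoder-respects : Respects≈ decoder
  decoder-respects {c} {c′} {d} c≈c′ eq
    with d′ , eq′ , d≈d′ ← decode-cong {c} {c′} c≈c′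
           (Maybe.map-injective word-injective (trans (sym (decoder-decode c)) eq)) =
    d′ , trans (decoder-decode c′) (cong (Maybe.map word) eq′) , d≈d′

  -- The first helper in a left list belongs to the scanned cell.
  HelpersMarked : List Bool → Set
  HelpersMarked ls =
    ∀ n → cellAt ls (suc (n * 2)) ≡ true → cellAt ls (suc (suc (n * 2))) ≡ true

  private
    -- Induction from the far end, one pair at a time: either only blanks have been read, or a
    -- marked helper has fixed the phase. Agreement is cellwise only, since the blanks skipped at
    -- the far end are missing from `os`.
    scan-paired : ∀ ls → HelpersMarked ls →
      (scan ls ≡ (leading , []) × (∀ n → cellAt ls n ≡ false)) ⊎
      (∃[ os ] scan ls ≡ (atSymbol , os) × cellAt os ≗ cellAt (odds ls))
    scan-paired []           _ = inj₁ (refl , λ _ → refl)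
    scan-paired (false ∷ []) _ = inj₁ (refl , λ { zero → refl ; (suc n) → refl })
    scan-paired (true ∷ [])  _ = inj₂ ([] , refl , λ _ → refl)
    scan-paired (h ∷ x ∷ ls) marked with scan-paired ls (marked ∘ suc)
    ... | inj₂ (os , eq , os≗) rewrite eq =
      inj₂ (x ∷ os , refl , λ { zero → refl ; (suc n) → os≗ n })
    ... | inj₁ (eq , blank) with x
    -- A 1 here would be a symbol whose own helper, the next cell, is blank.
    ...   | true  with () ← trans (sym (blank 0)) (marked 0 refl)
    scan-paired (false ∷ _ ∷ ls) marked | inj₁ (eq , blank) | false rewrite eq =
      inj₁ (refl , λ { zero → refl ; (suc zero) → refl ; (suc (suc n)) → blank n })
    scan-paired (true ∷ _ ∷ ls) marked | inj₁ (eq , blank) | false rewrite eq =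
      inj₂ ([] , refl , λ { zero    → refl
                          ; (suc n) → sym (trans (cellAt-odds ls n) (blank _)) })

  -- The marked helper of the scanned cell rules out the all-blank case, in which the decoder would
  -- reject.
  scan-marked : ∀ ls → cellAt ls 0 ≡ true → HelpersMarked ls →
                ∃[ os ] scan ls ≡ (atSymbol , os) × cellAt os ≗ cellAt (odds ls)
  scan-marked ls h marked with scan-paired ls marked
  ... | inj₁ (_ , blank) with () ← trans (sym (blank 0)) h
  ... | inj₂ result = result

-- The B machine

instructionIndex-inject₁ : ∀ {n} (i : Fin n) → instructionIndex (inject₁ i) ≡ just i
instructionIndex-inject₁ i rewrite view-inject₁ i = refl

instructionIndex-fromℕ : ∀ n → instructionIndex (fromℕ n) ≡ nothing
instructionIndex-fromℕ n rewrite view-fromℕ n = refl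

module Simulation (N : BinaryTM) (nonErasing : NonErasing N) where
  open BinaryTM N

  -- Non-erasure as monotonicity, the form in which `execute-write` takes it.
  rule-mono : ∀ {q x y D q′} → rule q x ≡ just (y , D , q′) → x ≡ true → y ≡ true
  rule-mono {y = true}  _  _    = refl
  rule-mono {y = false} eq refl = ⊥-elim (nonErasing _ _ _ eq)

  -- Per state, two instructions that inspect the symbol and two branches of six.
  size : ℕ
  size = suc lastState * 14

  -- Reached only when the scanned cell holds 0, so the jump falls through whatever its target.
  noOpOn0 : Instruction size
  noOpOn0 = J zero

  -- A symbol is the right half of its pair: the helper of the pair to the left is three cells away,
  -- that of the pair to the right only one. The two `M`s pad the second walk to the same length and
  -- mark a helper that is to be marked anyway.
  walk : Direction → Vec (Instruction size) 3
  walk L = L ∷ L ∷ L ∷ []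
  walk R = R ∷ M ∷ M ∷ []

  -- Entered on a symbol; leaves the head on the helper of the next pair.  In
  -- the block of the halt state the M's only lead to the end of the program.
  branch : Maybe (Bool × Direction × State) → Vec (Instruction size) 6
  branch nothing             = replicate 6 M
  branch (just (y , D , q′)) =
    (if y then M else noOpOn0) ∷ walk D Vec.++ M ∷ J (combine q′ 0F) ∷ []

  -- `R` steps from the helper to its symbol. On 1 the jump goes to the second branch, at offset 2 +
  -- 6 = 8; on 0 control falls into the first.
  block : State → Vec (Instruction size) 14
  block q = R ∷ J (combine q (8 ↑ʳ 0F)) ∷ branch (rule q false) Vec.++ branch (rule q true)

  instructionAt : State × Fin 14 → Instruction size
  instructionAt (q , j) = lookup (block q) j

  W : WangB
  W = record
    -- This makes `suc lastIndex` reduce to `size`.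
    { lastIndex = 13 + lastState * 14
    ; program   = tabulate (instructionAt ∘ remQuot 14)
    }

  𝒲 𝒩 : Machine
  𝒲 = wang W
  𝒩 = turing N

  -- Addresses and single instructions

  addr : State → Fin 14 → Fin (suc size)
  addr q j = inject₁ (combine q j)

  branchOffset : Bool → Fin 6 → Fin 14
  branchOffset false j = 2 ↑ʳ (j ↑ˡ 6)
  branchOffset true  j = 8 ↑ʳ j

  step-addr : ∀ q j s → step 𝒲 (config (addr q j) s) ≡
                        just (execute (combine q j) (lookup (block q) j) s)
  step-addr q j s rewrite instructionIndex-inject₁ (combine q j) =
    cong (λ I → just (execute (combine q j) I s))
      (trans (lookup∘tabulate (instructionAt ∘ remQuot 14) (combine q j))
             (cong instructionAt (remQuot-combine q j)))

  next-addr : ∀ q j j′ → toℕ j′ ≡ suc (toℕ j) → suc (combine q j) ≡ addr q j′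
  next-addr q j j′ eq = toℕ-injective (begin
    suc (toℕ (combine q j))   ≡⟨ cong suc (toℕ-combine q j) ⟩
    suc (14 * toℕ q + toℕ j)  ≡⟨ +-suc (14 * toℕ q) (toℕ j) ⟨
    14 * toℕ q + suc (toℕ j)  ≡⟨ cong (_+_ (14 * toℕ q)) eq ⟨
    14 * toℕ q + toℕ j′       ≡⟨ toℕ-combine q j′ ⟨
    toℕ (combine q j′)        ≡⟨ toℕ-inject₁ _ ⟨
    toℕ (addr q j′)           ∎)
    where open ≡-Reasoning

  -- The halt state is the last state, so its block ends the program and falling off the block means
  -- halting.
  past-end : suc (combine haltState (13 ↑ʳ 0F)) ≡ fromℕ size
  past-end = toℕ-injective (begin
    suc (toℕ (combine haltState last))  ≡⟨ cong suc (toℕ-combine haltState last) ⟩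
    suc (14 * toℕ haltState + 13)       ≡⟨ cong (λ n → suc (14 * n + 13)) (toℕ-fromℕ lastState) ⟩
    suc (14 * lastState + 13)           ≡⟨ cong suc (+-comm (14 * lastState) 13) ⟩
    14 + 14 * lastState                 ≡⟨ cong (_+_ 14) (*-comm 14 lastState) ⟩
    size                                ≡⟨ toℕ-fromℕ size ⟨
    toℕ (fromℕ size)                    ∎)
    where
    open ≡-Reasoning

    last : Fin 14
    last = 13 ↑ʳ 0F

  lookup-branch : ∀ q x j → lookup (block q) (branchOffset x j) ≡ lookup (branch (rule q x)) j
  lookup-branch q false j = lookup-++ˡ (branch (rule q false)) (branch (rule q true)) j
  lookup-branch q true  j = lookup-++ʳ (branch (rule q false)) (branch (rule q true)) j

  branchAddr : State → Bool → Fin 6 → Fin (suc size)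
  branchAddr q x j = addr q (branchOffset x j)

  next-branchAddr : ∀ q x (j : Fin 5) →
    suc (combine q (branchOffset x (inject₁ j))) ≡ branchAddr q x (suc j)
  next-branchAddr q false j = next-addr q _ _
    (cong (_+_ 2) (trans (toℕ-↑ˡ (suc j) 6)
      (sym (cong suc (trans (toℕ-↑ˡ (inject₁ j) 6) (toℕ-inject₁ j))))))
  next-branchAddr q true  j = next-addr q _ _
    (trans (toℕ-↑ʳ 8 (suc j))
      (sym (cong suc (trans (toℕ-↑ʳ 8 (inject₁ j)) (cong (_+_ 8) (toℕ-inject₁ j))))))

  step-branch : ∀ q x j s {r} → rule q x ≡ r →
    step 𝒲 (config (branchAddr q x j) s) ≡
    just (execute (combine q (branchOffset x j)) (lookup (branch r) j) s)
  step-branch q x j s refl =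
    trans (step-addr q (branchOffset x j) s)
          (cong (λ I → just (execute (combine q (branchOffset x j)) I s)) (lookup-branch q x j))

  -- For instructions that fall through wherever they stand; quantifying over `i` keeps address
  -- arithmetic out of the hypothesis.
  steps-branch : ∀ q x (j : Fin 5) {s s′ r} → rule q x ≡ r →
    (∀ i → execute i (lookup (branch r) (inject₁ j)) s ≡ config (suc i) s′) →
    Steps 𝒲 1 (config (branchAddr q x (inject₁ j)) s) (config (branchAddr q x (suc j)) s′)
  steps-branch q x j {s} {s′} eq executes = single
    (trans (step-branch q x (inject₁ j) s eq)
      (cong just (trans (executes _) (cong (λ i → config i s′) (next-branchAddr q x j)))))

  select : ∀ q ls x rs → Steps 𝒲 1 (config (addr q 1F) (tape ls x rs))
                                   (config (branchAddr q x 0F) (tape ls x rs))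
  select q ls true  rs = single (step-addr q 1F (tape ls true rs))
  select q ls false rs = single
    (trans (step-addr q 1F (tape ls false rs))
           (cong (λ i → just (config i (tape ls false rs))) (next-addr q 1F 2F refl)))

  enter : ∀ q s → Steps 𝒲 1 (config (addr q 0F) s) (config (addr q 1F) (moveRight s))
  enter q s = single
    (trans (step-addr q 0F s)
           (cong (λ i → just (config i (moveRight s))) (next-addr q 0F 1F refl)))

  -- The instruction cycle for one Turing step

  travel : Direction → Tape → Tape
  travel L = moveLeft ∘ moveLeft ∘ moveLeft
  travel R = write true ∘ write true ∘ moveRight

  -- For `y` = 1 the mark does the writing. For `y` = 0 the cell must already hold 0, and the jump
  -- falls through without changing it.
  execute-write : ∀ {x y} → (x ≡ true → y ≡ true) → ∀ {n} (i : Fin n) j ls rs →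
    execute i (if y then M else J j) (tape ls x rs) ≡ config (suc i) (tape ls y rs)
  execute-write {x}     {true}  _ i j ls rs = refl
  execute-write {false} {false} _ i j ls rs = refl
  execute-write {true}  {false} mono i j ls rs with () ← mono refl

  steps-walk : ∀ q x {y D q′} → rule q x ≡ just (y , D , q′) → ∀ s →
    Steps 𝒲 3 (config (branchAddr q x 1F) s) (config (branchAddr q x 4F) (travel D s))
  steps-walk q x {D = L} eq s =
    steps-branch q x 1F eq (λ _ → refl) ▷
    steps-branch q x 2F eq (λ _ → refl) ▷
    steps-branch q x 3F eq (λ _ → refl)
  steps-walk q x {D = R} eq s =
    steps-branch q x 1F eq (λ _ → refl) ▷
    steps-branch q x 2F eq (λ _ → refl) ▷
    steps-branch q x 3F eq (λ _ → refl)

  -- The `M` before it makes the jump unconditional. Splitting on `D` only lets `walk D` unfold.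
  steps-jump : ∀ q x {y D q′} → rule q x ≡ just (y , D , q′) → ∀ s →
    Steps 𝒲 2 (config (branchAddr q x 4F) s) (config (addr q′ 0F) (write true s))
  steps-jump q x {D = L} eq s =
    steps-branch q x 4F eq (λ _ → refl) ▷ single (step-branch q x 5F (write true s) eq)
  steps-jump q x {D = R} eq s =
    steps-branch q x 4F eq (λ _ → refl) ▷ single (step-branch q x 5F (write true s) eq)

  -- 8 = 1 + 1 + 3 + 2 + 1 in either direction, because the walks have equal length. The cycle runs
  -- from symbol to symbol, hence ends with the `R` of the next block.
  steps-cycle : ∀ q x {y D q′} ls rs → rule q x ≡ just (y , D , q′) →
    Steps 𝒲 8 (config (addr q 1F) (tape ls x rs))
              (config (addr q′ 1F) (moveRight (write true (travel D (tape ls y rs)))))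
  steps-cycle q x {y} {D} {q′} ls rs eq =
    select q ls x rs ▷
    steps-branch q x 0F eq (λ i → execute-write (rule-mono eq) i zero ls rs) ▷
    steps-walk q x eq (tape ls y rs) ▷
    steps-jump q x eq (travel D (tape ls y rs)) ▷
    enter q′ _

  -- Halting of the B machine

  idle : ∀ q x s → rule q x ≡ nothing →
    Steps 𝒲 5 (config (branchAddr q x 0F) s) (config (branchAddr q x 5F) (write true s))
  idle q x s eq =
    steps-branch q x 0F {s} {write true s} eq (λ _ → refl) ▷
    steps-branch q x 1F eq (λ _ → refl) ▷
    steps-branch q x 2F eq (λ _ → refl) ▷
    steps-branch q x 3F eq (λ _ → refl) ▷
    steps-branch q x 4F eq (λ _ → refl)

  haltState-rule : ∀ x → rule haltState x ≡ nothing
  haltState-rule x = Equivalence.from (rule-undefined haltState x) refl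

  haltsAt-lastBranch : ∀ s → HaltsAt 𝒲 (config (branchAddr haltState true 0F) s) 6
  haltsAt-lastBranch s =
    config (fromℕ size) (write true s) ,
    runs (idle haltState true s (haltState-rule true) ▷ single
      (trans (step-branch haltState true 5F (write true s) (haltState-rule true))
             (cong (λ i → just (config i (write true s))) past-end))) ,
    cong (Maybe.map _) (instructionIndex-fromℕ size)

  -- On 1, the jump and six `M`s. On 0 the jump falls through and the `M`s of the first branch lead
  -- into the second: 1 + 6 + 6 = 13.
  haltsWithin-haltState : ∀ ls x rs → HaltsWithin 𝒲 (config (addr haltState 1F) (tape ls x rs)) 13
  haltsWithin-haltState ls true rs =
    7 , m≤n+m 7 6 ,
    haltsAt-+ (select haltState ls true rs) 6 (haltsAt-lastBranch (tape ls true rs))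
  haltsWithin-haltState ls false rs =
    13 , ≤-refl ,
    haltsAt-+ (select haltState ls false rs ▷
               idle haltState false (tape ls false rs) (haltState-rule false) ▷
               single (trans (step-branch haltState false 5F marked (haltState-rule false))
                             (cong (λ i → just (config i marked))
                                   (next-addr haltState 7F 8F refl))))
              6 (haltsAt-lastBranch marked)
    where
    marked : Tape
    marked = tape ls true rs

  -- Effect of a cycle on the tape

  moveRight-travelL : ∀ ls y rs →
    moveRight (write true (travel L (tape ls y rs))) ≡
    tape (true ∷ drop 3 ls) (cellAt ls 1) (cellAt ls 0 ∷ y ∷ rs)
  moveRight-travelL []               y rs = refl
  moveRight-travelL (_ ∷ [])         y rs = refl
  moveRight-travelL (_ ∷ _ ∷ [])     y rs = refl
  moveRight-travelL (_ ∷ _ ∷ _ ∷ ls) y rs = refl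

  moveRight-travelR : ∀ ls y rs →
    moveRight (write true (travel R (tape ls y rs))) ≡
    tape (true ∷ y ∷ ls) (cellAt rs 1) (drop 2 rs)
  moveRight-travelR ls y []           = refl
  moveRight-travelR ls y (_ ∷ [])     = refl
  moveRight-travelR ls y (_ ∷ _ ∷ rs) = refl

  moveLeft-drop : ∀ ls y rs → moveLeft (tape ls y rs) ≡ tape (drop 1 ls) (cellAt ls 0) (y ∷ rs)
  moveLeft-drop []       y rs = refl
  moveLeft-drop (_ ∷ ls) y rs = refl

  moveRight-drop : ∀ ls y rs → moveRight (tape ls y rs) ≡ tape (y ∷ ls) (cellAt rs 0) (drop 1 rs)
  moveRight-drop ls y []       = refl
  moveRight-drop ls y (_ ∷ rs) = refl

  -- Decoding and the simulation relation

  decodeControl : Fin (suc size) → Maybe State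
  decodeControl i = Maybe.map (quotient 14) (instructionIndex i)

  decodeControl-addr : ∀ q j → decodeControl (addr q j) ≡ just q
  decodeControl-addr q j rewrite instructionIndex-inject₁ (combine q j) =
    cong (just ∘ proj₁) (remQuot-combine q j)

  open Encoder {suc lastState} {suc size} zero
  open Decoder decodeControl

  -- The head of `w` is on a symbol. Helpers to its right are unconstrained: the decoder ignores
  -- them, and the head marks each one on arrival.
  record Represents (s w : Tape) : Set where
    constructor represents
    field
      sameHead      : Tape.head w ≡ Tape.head s
      leftSymbols   : ∀ n → cellAt (Tape.left w) (suc (n * 2)) ≡ cellAt (Tape.left s) n
      rightSymbols  : ∀ n → cellAt (Tape.right w) (suc (n * 2)) ≡ cellAt (Tape.right s) n
      helperMarked  : cellAt (Tape.left w) 0 ≡ true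
      helpersMarked : HelpersMarked (Tape.left w)

  represents-move : ∀ D y {s w} → Represents s w →
    Represents (move D (write y s)) (moveRight (write true (travel D (write y w))))
  represents-move L y {tape ls x rs} {tape wl z wr} (represents _ left right h marked)
    rewrite moveLeft-drop ls y rs | moveRight-travelL wl y wr =
    represents (left 0)
      (λ n → trans (cellAt-drop 3 wl (n * 2)) (trans (left (suc n)) (sym (cellAt-drop 1 ls n))))
      (λ { zero → refl ; (suc n) → right n })
      refl
      (λ n eq → trans (cellAt-drop 3 wl (suc (n * 2)))
                      (marked (suc n) (trans (sym (cellAt-drop 3 wl (n * 2))) eq)))
  represents-move R y {tape ls x rs} {tape wl z wr} (represents _ left right h marked)
    rewrite moveRight-drop ls y rs | moveRight-travelR wl y wr =
    represents (right 0)
      (λ { zero → refl ; (suc n) → left n })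
      (λ n → trans (cellAt-drop 2 wr (suc (n * 2)))
                   (trans (right (suc n)) (sym (cellAt-drop 1 rs n))))
      refl
      -- The pair just left has a marked helper whatever `y` is.
      (λ { zero _ → h ; (suc n) eq → marked n eq })

  -- Address 1 of a block is reached when the head has just moved from the
  -- helper to its symbol.
  infix 4 _∼_
  data _∼_ : Conf 𝒩 → Conf 𝒲 → Set where
    checkpoint : ∀ {q s w} → Represents s w → config q s ∼ config (addr q 1F) w

  ∼-step : ∀ {c c′ b} → c ∼ b → step 𝒩 c ≡ just c′ →
           ∃[ b′ ] Steps 𝒲 8 b b′ × c′ ∼ b′
  ∼-step (checkpoint {q} {tape ls x rs} {tape wl _ wr} r@(represents refl _ _ _ _)) eq
    with rule q x in rule≡
  ∼-step (checkpoint {q} {tape ls x rs} {tape wl _ wr} r@(represents refl _ _ _ _)) refl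
    | just (y , D , q′) =
    _ , steps-cycle q x wl wr rule≡ , checkpoint (represents-move D y r)

  ∼-run : ∀ n {c c′ b} → c ∼ b → run 𝒩 n c ≡ just c′ →
          ∃[ b′ ] Steps 𝒲 (n * 8) b b′ × c′ ∼ b′
  ∼-run zero    c∼b refl = _ , steps refl , c∼b
  ∼-run (suc n) {c} c∼b eq with step 𝒩 c in step≡
  ... | just c₁ with b₁ , r₁ , c₁∼b₁ ← ∼-step c∼b step≡
                with b′ , r′ , c′∼b′ ← ∼-run n c₁∼b₁ eq =
    b′ , r₁ ▷ r′ , c′∼b′

  ∼-halt : ∀ {c b} → c ∼ b → step 𝒩 c ≡ nothing → HaltsWithin 𝒲 b 13
  ∼-halt (checkpoint {q} {tape ls x rs} {tape wl z wr} _) eq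
    with rule q x in rule≡
  ... | nothing with refl ← Equivalence.to (rule-undefined q x) rule≡ =
    haltsWithin-haltState wl z wr

  ∼-decode : ∀ {c b} → c ∼ b → ∃[ a ] decoder ⊢ b ↦ a × a ≈ c
  ∼-decode (checkpoint {q} {tape ls x rs} {w@(tape wl _ wr)} (represents refl left right h marked))
    with os , scan≡ , os≗ ← scan-marked wl h marked =
    config q (tape os x (odds wr)) ,
    trans (decoder-decode (config (addr q 1F) w)) (cong (Maybe.map word) decode≡) ,
    refl ,
    read-cong (λ n → trans (os≗ n) (trans (cellAt-odds wl n) (left n)))
              refl
              (λ n → trans (cellAt-odds wr n) (right n))
    where
    decode≡ : decode (config (addr q 1F) w) ≡ just (config q (tape os x (odds wr)))
    decode≡ rewrite scan≡ | decodeControl-addr q 1F = refl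

  -- The first `R` moves the head from the marked helper to its symbol. Since `double` makes every
  -- other helper equal to its symbol, a symbol 1 has a marked helper.
  encode-∼ : ∀ s → ∃[ b ] Steps 𝒲 1 (encode (config zero s)) b × config zero s ∼ b
  encode-∼ s@(tape ls x rs) =
    _ , enter zero (content (encode (config zero s))) ,
    checkpoint (represents refl (cellAt-double-even ls) (cellAt-double-odd rs) refl
      (λ n eq → trans (cellAt-double-odd ls n) (trans (sym (cellAt-double-even ls n)) eq)))

  -- Time bound and halting

  bound : ℕ → ℕ
  -- One initial `R`, eight instructions per Turing step, at most 13 to halt.
  bound t = suc (t * 8) + 13

  bound-linear : bound ∈O (λ t → t)
  -- 22 = 8 + 14, and the threshold is 1 because 14 ≤ `n * 14` needs a positive `n`.
  bound-linear = 22 , 1 , λ { n@(suc _) _ → begin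
    suc (n * 8) + 13  ≡⟨ +-suc (n * 8) 13 ⟨
    n * 8 + 14        ≤⟨ +-monoʳ-≤ (n * 8) (m≤n*m 14 n) ⟩
    n * 8 + n * 14    ≡⟨ *-distribˡ-+ n 8 14 ⟨
    n * 22            ≡⟨ *-comm n 22 ⟩
    22 * n            ∎ }
    where open ≤-Reasoning

  module Run (s : Tape) where
    c₀ : Conf 𝒩
    c₀ = config zero s

    b₀ : Conf 𝒲
    b₀ = encode c₀

    run-from-b₀ : ∀ n {c} → run 𝒩 n c₀ ≡ just c →
                  ∃[ b ] Steps 𝒲 (suc (n * 8)) b₀ b × c ∼ b
    run-from-b₀ n eq
      with b₁ , r₁ , c₀∼b₁ ← encode-∼ s
      with b , r , c∼b ← ∼-run n c₀∼b₁ eq = b , r₁ ▷ r , c∼b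

    passesThrough : PassesThrough 𝒲 𝒩 decoder b₀ c₀
    passesThrough = (λ i → suc (i * 8)) , (λ i → s≤s (s≤s (m≤n+m (i * 8) 7))) , passes
      where
      passes : ∀ i c → run 𝒩 i c₀ ≡ just c →
               ∃₂ λ b a → run 𝒲 (suc (i * 8)) b₀ ≡ just b × decoder ⊢ b ↦ a × a ≈ c
      passes i c eq with b , r , c∼b ← run-from-b₀ i eq
                    with a , b↦a , a≈c ← ∼-decode c∼b = b , a , runs r , b↦a , a≈c

    haltsWithin : ∀ t → HaltsWithin 𝒩 c₀ t → HaltsWithin 𝒲 b₀ (bound t)
    haltsWithin t (n , n≤t , c , run≡ , halted)
      with b , r , c∼b ← run-from-b₀ n run≡
      with m , m≤13 , haltsAt ← ∼-halt c∼b halted =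
      suc (n * 8) + m , +-mono-≤ (s≤s (*-monoˡ-≤ 8 n≤t)) m≤13 ,
      haltsAt-+ r m haltsAt

    -- If `𝒩` could make `n` steps, `𝒲` would make `suc (n * 8)` steps, yet it halts after `n`. So
    -- the run of `𝒩` ends earlier.
    halts⇒halts : Halts 𝒲 b₀ → Halts 𝒩 c₀
    halts⇒halts (n , haltsAt) with run 𝒩 n c₀ in run≡
    ... | nothing = run-nothing⇒halts 𝒩 n run≡
    ... | just c  with b , r , _ ← run-from-b₀ n run≡
                  with () ← trans (sym (runs r)) (run-past-halt 𝒲 {n} haltsAt (s≤s (m≤m*n n 8)))

    halts⇔halts : Halts 𝒲 b₀ ⇔ Halts 𝒩 c₀
    halts⇔halts = mk⇔ halts⇒halts λ (n , haltsAt) →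
      let m , _ , haltsAt′ = haltsWithin n (n , ≤-refl , haltsAt) in m , haltsAt′

  simulation : 𝒲 Simulates 𝒩 InTimeO (λ t → t)
  simulation = record
    { ε          = encoder
    ; δ          = decoder
    ; ε-respects = encoder-respects
    ; δ-respects = decoder-respects
    ; f          = bound
    ; f∈O-g      = bound-linear
    ; simulates  = λ { c₀@(config _ s) refl →
        encode c₀ , encoder-encode c₀ , refl ,
        Run.passesThrough s , Run.halts⇔halts s , Run.haltsWithin s }
    }

theorem7 : (N : BinaryTM) → NonErasing N →
    ∃[ W ] (wang W Simulates turing N InTimeO (λ t → t))
theorem7 N nonErasing = W , simulation
  where open Simulation N nonErasing
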